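{- Let $k\ge 1$ be an integer. Every regular $\underline{\mathcal{P}_k}$-independent code $X\subseteq A^*$ can be embedded into some complete one; that is, there exists a complete regular $\underline{\mathcal{P}_k}$-independent code $Z\subseteq A^*$ with $X\subseteq Z$.
   Context: $A$ is a finite alphabet with $|A|\ge 2$; $A^*$ is the free monoid over $A$ and $|w|$ is the length of $w$. A subset of $A^*$ is regular if it is recognized by a finite automaton. A set $X\subseteq A^*$ is a code if for all words $x_1,\dots,x_n,y_1,\dots,y_p\in X$, $x_1\cdots x_n=y_1\cdots y_p$ implies $n=p$ and $x_i=y_i$ for every $i$. $X$ is complete if every word of $A^*$ is a factor (contiguous subword) of some word in $X^*$, the submonoid generated by $X$. For $w,w'\in A^*$, $w\wedge w'$ is their longest common prefix; $(w,w')\in\mathcal{P}_k$ iff $|w|+|w'|-2|w\wedge w'|\le k$, and $\underline{\mathcal{P}_k}=\mathcal{P}_k\setminus\{(w,w):w\in A^*\}$. For a relation $\tau\subseteq A^*\times A^*$, $\tau(X)=\{y:\exists x\in X,\ (x,y)\in\tau\}$, and $X$ is $\tau$-independent if $\tau(X)\cap X=\emptyset$. -}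

module Defs where

open import Data.Bool.Base using (true; false)
open import Data.Fin.Base using (Fin)
open import Data.Fin.Properties using (inj⇒≟)
open import Data.Fin.Subset using (Subset) renaming (_∈_ to _∈ˢ_)
open import Data.List.Base using (List; []; _∷_; _++_; concat; foldl; length)
open import Data.List.Relation.Binary.Infix.Heterogeneous using (Infix)
open import Data.List.Relation.Unary.All using (All)
open import Data.Nat.Base using (ℕ; _+_; _*_; _∸_; _≤_)
open import Data.Product.Base using (∃-syntax; _×_)
open import Function.Bundles using (_↔_)
open import Function.Properties.Inverse using (↔⇒↣)
open import Level using (0ℓ)
open import Relation.Binary.Core using (Rel)
open import Relation.Binary.Definitions using (DecidableEquality)
open import Relation.Binary.PropositionalEquality using (_≡_; _≢_)
open import Relation.Nullary.Decidable.Core using (does)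
open import Relation.Unary using (Pred; _∈_; _∩_; _≐_; Empty)

Language : Set → Set₁
Language A = Pred (List A) 0ℓ

-- Deterministic complete automata; they recognize the same languages as
-- nondeterministic ones.
record Automaton (A : Set) : Set where
  field
    states  : ℕ
    initial : Fin states
    δ       : Fin states → A → Fin states
    final   : Subset states

  accepted : Language A
  accepted w = foldl δ initial w ∈ˢ final

Regular : {A : Set} → Language A → Set
Regular {A} X = ∃[ M ] X ≐ Automaton.accepted {A} M

-- The sequences may be empty. This agrees with the definition on nonempty
-- sequences: either version forces [] ∉ X, so that a product of words of X
-- is [] only if the sequence is empty.
Code : {A : Set} → Language A → Set
Code X = ∀ xs ys → All X xs → All X ys → concat xs ≡ concat ys → xs ≡ ys

Star : {A : Set} → Language A → Language A
Star X w = ∃[ xs ] All X xs × concat xs ≡ w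

Factor : {A : Set} → Rel (List A) 0ℓ
Factor = Infix _≡_

Complete : {A : Set} → Language A → Set
Complete X = ∀ w → ∃[ v ] v ∈ Star X × Factor w v

Image : {A : Set} → Rel (List A) 0ℓ → Language A → Language A
Image τ X y = ∃[ x ] x ∈ X × τ x y

Independent : {A : Set} → Rel (List A) 0ℓ → Language A → Set
Independent τ X = Empty (Image τ X ∩ X)

longestCommonPrefix : {A : Set} → DecidableEquality A → List A → List A → List A
longestCommonPrefix _≟_ []      _       = []
longestCommonPrefix _≟_ (_ ∷ _) []      = []
longestCommonPrefix _≟_ (a ∷ v) (b ∷ w) with does (a ≟ b)
... | true  = a ∷ longestCommonPrefix _≟_ v w
... | false = []

module _ {A : Set} {n : ℕ} (A↔Fin : A ↔ Fin n) where

  infixl 7 _∧_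

  _∧_ : List A → List A → List A
  _∧_ = longestCommonPrefix (inj⇒≟ (↔⇒↣ A↔Fin))

  -- The subtraction never truncates, since v ∧ w is a prefix of v and of w.
  𝒫 : ℕ → Rel (List A) 0ℓ
  𝒫 k v w = (length v + length w) ∸ 2 * length (v ∧ w) ≤ k

  𝒫̲ : ℕ → Rel (List A) 0ℓ
  𝒫̲ k v w = 𝒫 k v w × v ≢ w

{-# OPTIONS --safe #-}

-- If X is not complete, some word is a factor of no word of X*; extended by a
-- letter a in front it becomes v, and z = v a b^m with a ≠ b and m large overlaps
-- itself only trivially. As for the Ehrenfeucht–Rozenberg completion,
-- Z = X ∪ (z G)* z, where G is the set of words outside X* in which z does not occur.
-- Cancelling at most k ≤ m letters of a word of (z G)* z leaves an ending v a b^i: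
-- it contains v, which keeps the word away from X, and i together with the rest of
-- the word can be read off, which separates such words from each other.
module Submission where

open import Defs
open import Data.Empty using (⊥)
open import Data.Fin.Base using (Fin; finToFun; funToFin; suc; toℕ; zero)
open import Data.Fin.Properties using (+↔⊎; 2↔Bool; any?; finToFun-funToFin; inj⇒≟; pigeonhole; toℕ≤pred[n]) renaming (_≟_ to _≟ᶠ_)
open import Data.Fin.Subset using (Subset; ⊤) renaming (_∈_ to _∈ˢ_; ∁ to ∁ˢ)
open import Data.Fin.Subset.Properties using (_∈?_; x∈∁p⇒x∉p; x∉p⇒x∈∁p; ∈⊤)
open import Data.List.Base using (List; []; [_]; _++_; _∷_; _∷ʳ_; concat; drop; foldl; length; replicate; take)
open import Data.List.Properties using (++-assoc; ++-cancelʳ; ++-cancelˡ; ++-identityʳ; concat-++; foldl-++; length-++; length-++-comm; length-++-≤ʳ; length-++-≤ˡ; length-drop; length-replicate; length-take; take++drop≡id; ∷-injective; ∷ʳ-++)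
open import Data.List.Relation.Binary.Infix.Heterogeneous using (MkView; fromView; here; toView)
open import Data.List.Relation.Binary.Infix.Heterogeneous.Properties using (∷⁻) renaming (trans to Infix-trans)
open import Data.List.Relation.Binary.Pointwise using (Pointwise-≡⇒≡; ≡⇒Pointwise-≡)
open import Data.List.Relation.Binary.Prefix.Heterogeneous as Prefix using (Prefix; [])
open import Data.List.Relation.Binary.Prefix.Heterogeneous.Properties using (prefix?)
open import Data.List.Relation.Unary.All as All using (All; []; _∷_)
open import Data.List.Relation.Unary.All.Properties using (++⁺)
open import Data.Nat.Base using (_*_; _+_; _<_; _^_; _∸_; _≤_; suc; s≤s; s≤s⁻¹; z<s; zero; z≤n; ℕ)
open import Data.Nat.Induction using (<-wellFounded; Acc; acc)
open import Data.Nat.Properties using (+-cancelʳ-≤; +-mono-<-≤; +-monoʳ-≤; +-monoˡ-<; +-monoˡ-≤; <-≤-trans; <⇒≢; m+[n∸m]≡n; m+n∸m≡n; m+n≤o⇒m≤o; m+n≤o⇒n≤o; m<m+n; m<n+m; module ≤-Reasoning; m≤m+n; m≤n+m; m⊓n≤m; n<1+n; ≤-<-connex; ≤-refl; ≤-total; ≤-trans)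
open import Data.Nat.Tactic.RingSolver using (solve-∀)
open import Data.Product.Base using (_,_; _×_; proj₁; proj₂; Σ-syntax; ∃-syntax)
open import Data.Sum.Base using ([_,_]′; _⊎_; inj₁; inj₂)
open import Data.Sum.Properties using (≡-dec)
open import Data.Vec.Base using (lookup; tabulate)
open import Data.Vec.Properties using ([]=⇒lookup; lookup⇒[]=; lookup∘tabulate; tabulate-cong; tabulate∘lookup)
open import Function.Base using (_∘_; case_of_)
open import Function.Bundles using (Equivalence; Inverse; RightInverse; _↔_; _↪_; _⇔_; mk↪; mk⇔)
open import Function.Construct.Identity using (↪-id)
open import Function.Properties.Inverse using (↔-sym; ↔⇒↣; ↔⇒↪)
open import Level using (0ℓ)
open import Relation.Binary.Definitions using (DecidableEquality)
open import Relation.Binary.PropositionalEquality using (_≡_; _≢_; cong; cong₂; module ≡-Reasoning; refl; subst; subst₂; sym; trans)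
open import Relation.Nullary.Decidable using (Dec; _×-dec_; _⊎-dec_; dec-true; decidable-stable; does; map′; no; yes)
open import Relation.Nullary.Negation using (contradiction; ¬_)
open import Relation.Unary using (Decidable; Pred; U; _∈_; _∉_; _∪_; _≐_; _⊆_; ∁)

open Automaton

-- Closure properties of regular languages

comprehension : ∀ {n} {P : Pred (Fin n) 0ℓ} → Decidable P → Subset n
comprehension P? = tabulate (does ∘ P?)

∈-comprehension : ∀ {n} {P : Pred (Fin n) 0ℓ} (P? : Decidable P) {i} →
                  i ∈ˢ comprehension P? ⇔ P i
∈-comprehension P? {i} = mk⇔ to from
  where
  to : i ∈ˢ comprehension P? → _
  to i∈ with P? i | trans (sym (lookup∘tabulate (does ∘ P?) i)) ([]=⇒lookup i∈)
  ... | yes p | _ = p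
  from : _ → i ∈ˢ comprehension P?
  from p = lookup⇒[]= i _ (trans (lookup∘tabulate (does ∘ P?) i) (dec-true (P? i) p))

-- States of an automaton are numbers, so a set of states is coded by its bit vector, read as a
-- number below `2 ^ n`.
Subset↪Fin : ∀ {n} → Subset n ↪ Fin (2 ^ n)
Subset↪Fin {n} = mk↪ {to = to′} {from = from′} (λ { refl → from∘to _ })
  where
  module B = Inverse 2↔Bool
  to′ : Subset n → Fin (2 ^ n)
  to′ p = funToFin (B.from ∘ lookup p)
  from′ : Fin (2 ^ n) → Subset n
  from′ c = tabulate (B.to ∘ finToFun c)
  from∘to : ∀ p → from′ (to′ p) ≡ p
  from∘to p = trans
    (tabulate-cong λ i → trans (cong B.to (finToFun-funToFin (B.from ∘ lookup p) i))
                               (B.strictlyInverseˡ (lookup p i)))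
    (tabulate∘lookup p)

Residual : ∀ {A} (M : Automaton A) → Fin (states M) → Language A
Residual M q w = foldl (δ M) q w ∈ˢ final M

infixr 7 _·_

_·_ : ∀ {A} → Language A → Language A → Language A
(K · L) w = ∃[ u ] ∃[ v ] u ++ v ≡ w × u ∈ K × v ∈ L

Word : ∀ {A : Set} → List A → Language A
Word z w = w ≡ z

·-mono : ∀ {A} {K K′ L L′ : Language A} → K ⊆ K′ → L ⊆ L′ → K · L ⊆ K′ · L′
·-mono f g (u , v , eq , u∈ , v∈) = u , v , eq , f u∈ , g v∈

Star-mono : ∀ {A} {K L : Language A} → K ⊆ L → Star K ⊆ Star L
Star-mono f (xs , xs∈ , eq) = xs , All.map f xs∈ , eq

Star-∷ : ∀ {A} {X : Language A} {u v} → u ∈ X → v ∈ Star X → u ++ v ∈ Star X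
Star-∷ {u = u} u∈ (xs , xs∈ , refl) = u ∷ xs , u∈ ∷ xs∈ , refl

Regular-resp-≐ : ∀ {A} {K L : Language A} → K ≐ L → Regular K → Regular L
Regular-resp-≐ (f , g) (M , h , i) = M , h ∘ g , f ∘ i

Regular⇒Decidable : ∀ {A} {L : Language A} → Regular L → Decidable L
Regular⇒Decidable (M , f , g) w = map′ g f (foldl (δ M) (initial M) w ∈? final M)

∁-regular : ∀ {A} {L : Language A} → Regular L → Regular (∁ L)
∁-regular (M , f , g) =
  record { states = states M ; initial = initial M ; δ = δ M ; final = ∁ˢ (final M) } ,
  (λ w∉ → x∉p⇒x∈∁p (w∉ ∘ g)) , (λ w∈ → x∈∁p⇒x∉p w∈ ∘ f)

-- The languages K q are those recognized from the states of a nondeterministic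
-- automaton, described by its left derivatives.
system-regular :
  ∀ {A m} {Q : Set} → Q ↪ Fin m →
  (K : Q → Language A) → (∀ q → Dec ([] ∈ K q)) →
  {Δ : Q → A → Pred Q 0ℓ} → (∀ q a → Decidable (Δ q a)) →
  (∀ q a w → a ∷ w ∈ K q ⇔ (∃[ r ] Δ q a r × w ∈ K r)) →
  {I : Pred Q 0ℓ} → Decidable I →
  Regular (λ w → ∃[ q ] I q × w ∈ K q)
system-regular {A} {m} {Q} Q↪ K ν? {Δ} Δ? derivative {I} I? = M , to-M , from-M
  where
  module Q = RightInverse Q↪
  module S = RightInverse (Subset↪Fin {m})
  open Equivalence

  -- Subset construction: a state of `M` codes the set of all states that the nondeterministic runs
  -- can have reached.
  step? : ∀ T a → Decidable (λ j → ∃[ i ] i ∈ˢ T × Δ (Q.from i) a (Q.from j))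
  step? T a j = any? (λ i → i ∈? T ×-dec Δ? (Q.from i) a (Q.from j))

  step : Subset m → A → Subset m
  step T a = comprehension (step? T a)

  start? : Decidable (λ i → I (Q.from i))
  start? i = I? (Q.from i)

  start : Subset m
  start = comprehension start?

  nullable? : Decidable (λ c → ∃[ i ] i ∈ˢ S.from c × [] ∈ K (Q.from i))
  nullable? c = any? (λ i → i ∈? S.from c ×-dec ν? (Q.from i))

  M : Automaton A
  M = record { states = 2 ^ m ; initial = S.to start
             ; δ = λ c a → S.to (step (S.from c) a) ; final = comprehension nullable? }

  ⟦_⟧ : Subset m → Language A
  ⟦ T ⟧ w = ∃[ i ] i ∈ˢ T × w ∈ K (Q.from i)

  step-⟦⟧ : ∀ T a w → w ∈ ⟦ step T a ⟧ ⇔ a ∷ w ∈ ⟦ T ⟧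
  step-⟦⟧ T a w = mk⇔ f g
    where
    f : w ∈ ⟦ step T a ⟧ → a ∷ w ∈ ⟦ T ⟧
    f (j , j∈ , w∈) with i , i∈T , ij ← to (∈-comprehension (step? T a)) j∈ =
      i , i∈T , from (derivative _ a w) (Q.from j , ij , w∈)
    g : a ∷ w ∈ ⟦ T ⟧ → w ∈ ⟦ step T a ⟧
    g (i , i∈T , aw∈) with r , ir , w∈ ← to (derivative _ a w) aw∈ =
      Q.to r ,
      from (∈-comprehension (step? T a)) (i , i∈T , subst (Δ _ a) (sym (Q.strictlyInverseʳ r)) ir) ,
      subst (λ r → w ∈ K r) (sym (Q.strictlyInverseʳ r)) w∈

  -- Induction on `w`, for all codes `c` at once: decoding undoes coding, so the correspondence
  -- survives each transition of `M`.
  residual : ∀ c w → w ∈ Residual M c ⇔ w ∈ ⟦ S.from c ⟧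
  residual c []      = ∈-comprehension nullable?
  residual c (a ∷ w) = mk⇔
    (λ w∈ → to (step-⟦⟧ _ a w) (subst (λ T → w ∈ ⟦ T ⟧) (S.strictlyInverseʳ _) (to (residual _ w) w∈)))
    (λ w∈ → from (residual _ w) (subst (λ T → w ∈ ⟦ T ⟧) (sym (S.strictlyInverseʳ _)) (from (step-⟦⟧ _ a w) w∈)))

  L : Language A
  L w = ∃[ q ] I q × w ∈ K q

  to-M : L ⊆ accepted M
  to-M {w} (q , q∈I , w∈) = from (residual _ w) (subst (λ T → w ∈ ⟦ T ⟧) (sym (S.strictlyInverseʳ start))
    (Q.to q , from (∈-comprehension start?) (subst I (sym (Q.strictlyInverseʳ q)) q∈I) ,
     subst (λ r → w ∈ K r) (sym (Q.strictlyInverseʳ q)) w∈))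

  from-M : accepted M ⊆ L
  from-M {w} w∈ with i , i∈ , w∈K ← subst (λ T → w ∈ ⟦ T ⟧) (S.strictlyInverseʳ start) (to (residual _ w) w∈) =
    Q.from i , to (∈-comprehension start?) i∈ , w∈K

state-regular :
  ∀ {A m} {Q : Set} → Q ↪ Fin m → DecidableEquality Q →
  (K : Q → Language A) → (∀ q → Dec ([] ∈ K q)) →
  {Δ : Q → A → Pred Q 0ℓ} → (∀ q a → Decidable (Δ q a)) →
  (∀ q a w → a ∷ w ∈ K q ⇔ (∃[ r ] Δ q a r × w ∈ K r)) →
  ∀ q → Regular (K q)
state-regular Q↪ _≟_ K ν? Δ? derivative q =
  Regular-resp-≐ ((λ { (_ , refl , w∈) → w∈ }) , (λ w∈ → q , refl , w∈))
    (system-regular Q↪ K ν? Δ? derivative (λ r → r ≟ q))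

-- Automata for union, product, star and single words

⊎↪Fin : ∀ {m n} → (Fin m ⊎ Fin n) ↪ Fin _
⊎↪Fin {m} {n} = ↔⇒↪ (↔-sym (+↔⊎ {m} {n}))

-- The disjoint union of the two automata, with both initial states.
∪-regular : ∀ {A} {K L : Language A} → Regular K → Regular L → Regular (K ∪ L)
∪-regular {A} {K} {L} (M , KM , MK) (N , LN , NL) =
  Regular-resp-≐ (f , g) (system-regular ⊎↪Fin R ν? {Δ} Δ? derivative {I} I?)
  where
  R : Fin (states M) ⊎ Fin (states N) → Language A
  R (inj₁ q) = Residual M q
  R (inj₂ q) = Residual N q
  ν? : ∀ q → Dec ([] ∈ R q)
  ν? (inj₁ q) = q ∈? final M
  ν? (inj₂ q) = q ∈? final N
  Δ : Fin (states M) ⊎ Fin (states N) → A → Pred (Fin (states M) ⊎ Fin (states N)) 0ℓ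
  Δ (inj₁ q) a (inj₁ r) = r ≡ δ M q a
  Δ (inj₂ q) a (inj₂ r) = r ≡ δ N q a
  Δ _        a _        = ⊥
  Δ? : ∀ q a → Decidable (Δ q a)
  Δ? (inj₁ q) a (inj₁ r) = r ≟ᶠ δ M q a
  Δ? (inj₂ q) a (inj₂ r) = r ≟ᶠ δ N q a
  Δ? (inj₁ q) a (inj₂ r) = no λ ()
  Δ? (inj₂ q) a (inj₁ r) = no λ ()
  derivative : ∀ q a w → a ∷ w ∈ R q ⇔ (∃[ r ] Δ q a r × w ∈ R r)
  derivative (inj₁ q) a w = mk⇔ (λ w∈ → inj₁ _ , refl , w∈) λ { (inj₁ _ , refl , w∈) → w∈ }
  derivative (inj₂ q) a w = mk⇔ (λ w∈ → inj₂ _ , refl , w∈) λ { (inj₂ _ , refl , w∈) → w∈ }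
  I : Pred (Fin (states M) ⊎ Fin (states N)) 0ℓ
  I (inj₁ q) = q ≡ initial M
  I (inj₂ q) = q ≡ initial N
  I? : Decidable I
  I? (inj₁ q) = q ≟ᶠ initial M
  I? (inj₂ q) = q ≟ᶠ initial N
  f : (λ w → ∃[ q ] I q × w ∈ R q) ⊆ K ∪ L
  f (inj₁ _ , refl , w∈) = inj₁ (MK w∈)
  f (inj₂ _ , refl , w∈) = inj₂ (NL w∈)
  g : K ∪ L ⊆ (λ w → ∃[ q ] I q × w ∈ R q)
  g (inj₁ w∈) = inj₁ _ , refl , KM w∈
  g (inj₂ w∈) = inj₂ _ , refl , LN w∈


-- In a state `inj₁ q` the first factor is still being read. If `q` is final, the next letter may
-- also open the second factor, which replaces an empty transition.
·-regular : ∀ {A} {K L : Language A} → Regular K → Regular L → Regular (K · L)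
·-regular {A} {K} {L} (M , KM , MK) (N , LN , NL) =
  Regular-resp-≐ (·-mono MK NL , ·-mono KM LN)
    (state-regular ⊎↪Fin (≡-dec _≟ᶠ_ _≟ᶠ_) R ν? {Δ} Δ? derivative (inj₁ (initial M)))
  where
  R : Fin (states M) ⊎ Fin (states N) → Language A
  R (inj₁ q) = Residual M q · accepted N
  R (inj₂ q) = Residual N q
  ν? : ∀ q → Dec ([] ∈ R q)
  ν? (inj₁ q) = map′ (λ { (q∈ , n∈) → [] , [] , refl , q∈ , n∈ })
                     (λ { ([] , [] , refl , q∈ , n∈) → q∈ , n∈ })
                     (q ∈? final M ×-dec initial N ∈? final N)
  ν? (inj₂ q) = q ∈? final N
  Δ : Fin (states M) ⊎ Fin (states N) → A → Pred (Fin (states M) ⊎ Fin (states N)) 0ℓ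
  Δ (inj₁ q) a (inj₁ r) = r ≡ δ M q a
  Δ (inj₁ q) a (inj₂ r) = q ∈ˢ final M × r ≡ δ N (initial N) a
  Δ (inj₂ q) a (inj₂ r) = r ≡ δ N q a
  Δ (inj₂ q) a (inj₁ r) = ⊥
  Δ? : ∀ q a → Decidable (Δ q a)
  Δ? (inj₁ q) a (inj₁ r) = r ≟ᶠ δ M q a
  Δ? (inj₁ q) a (inj₂ r) = q ∈? final M ×-dec r ≟ᶠ δ N (initial N) a
  Δ? (inj₂ q) a (inj₂ r) = r ≟ᶠ δ N q a
  Δ? (inj₂ q) a (inj₁ r) = no λ ()
  derivative : ∀ q a w → a ∷ w ∈ R q ⇔ (∃[ r ] Δ q a r × w ∈ R r)
  derivative (inj₁ q) a w = mk⇔ to from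
    where
    to : a ∷ w ∈ R (inj₁ q) → ∃[ r ] Δ (inj₁ q) a r × w ∈ R r
    to ([]    , _ , refl , u∈ , v∈) = inj₂ _ , (u∈ , refl) , v∈
    to (_ ∷ u , v , refl , u∈ , v∈) = inj₁ _ , refl , u , v , refl , u∈ , v∈
    from : ∃[ r ] Δ (inj₁ q) a r × w ∈ R r → a ∷ w ∈ R (inj₁ q)
    from (inj₁ _ , refl , u , v , refl , u∈ , v∈) = a ∷ u , v , refl , u∈ , v∈
    from (inj₂ _ , (q∈ , refl) , w∈)              = [] , a ∷ w , refl , q∈ , w∈
  derivative (inj₂ q) a w = mk⇔ (λ w∈ → inj₂ _ , refl , w∈) λ { (inj₂ _ , refl , w∈) → w∈ }

-- The start `zero` is separate from the copy of `initial M`, so accepting `[]` there does not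
-- accept words that return to `initial M` in mid-factor. At `suc q` with `q` final, the next letter
-- may open a new factor.
Star-regular : ∀ {A} {X : Language A} → Regular X → Regular (Star X)
Star-regular {A} {X} (M , XM , MX) =
  Regular-resp-≐ (Star-mono MX , Star-mono XM)
    (state-regular (↪-id _) _≟ᶠ_ R ν? {Δ} Δ? derivative zero)
  where
  R : Fin (suc (states M)) → Language A
  R zero    = Star (accepted M)
  R (suc q) = Residual M q · Star (accepted M)
  ν? : ∀ q → Dec ([] ∈ R q)
  ν? zero    = yes ([] , [] , refl)
  ν? (suc q) = map′ (λ q∈ → [] , [] , refl , q∈ , [] , [] , refl)
                    (λ { ([] , [] , refl , q∈ , _) → q∈ }) (q ∈? final M)
  Δ : Fin (suc (states M)) → A → Pred (Fin (suc (states M))) 0ℓ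
  Δ _       a zero    = ⊥
  Δ zero    a (suc r) = r ≡ δ M (initial M) a
  Δ (suc q) a (suc r) = r ≡ δ M q a ⊎ q ∈ˢ final M × r ≡ δ M (initial M) a
  Δ? : ∀ q a → Decidable (Δ q a)
  Δ? zero    a zero    = no λ ()
  Δ? (suc q) a zero    = no λ ()
  Δ? zero    a (suc r) = r ≟ᶠ δ M (initial M) a
  Δ? (suc q) a (suc r) = r ≟ᶠ δ M q a ⊎-dec (q ∈? final M ×-dec r ≟ᶠ δ M (initial M) a)
  -- Empty factors are skipped; the letter `a` comes from the first nonempty one.
  first : ∀ {a w} xs → All (accepted M) xs → concat xs ≡ a ∷ w → w ∈ R (suc (δ M (initial M) a))
  first ([] ∷ xs)      (_ ∷ xs∈)  eq   = first xs xs∈ eq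
  first ((_ ∷ x) ∷ xs) (x∈ ∷ xs∈) refl = x , concat xs , refl , x∈ , xs , xs∈ , refl
  derivative : ∀ q a w → a ∷ w ∈ R q ⇔ (∃[ r ] Δ q a r × w ∈ R r)
  derivative zero a w = mk⇔
    (λ { (xs , xs∈ , eq) → suc _ , refl , first xs xs∈ eq })
    λ { (suc _ , refl , u , v , refl , u∈ , v∈) → Star-∷ {X = accepted M} {u = a ∷ u} u∈ v∈ }
  derivative (suc q) a w = mk⇔ to from
    where
    to : a ∷ w ∈ R (suc q) → ∃[ r ] Δ (suc q) a r × w ∈ R r
    to ([]    , _ , refl , u∈ , xs , xs∈ , eq) = suc _ , inj₂ (u∈ , refl) , first xs xs∈ eq
    to (_ ∷ u , v , refl , u∈ , v∈)            = suc _ , inj₁ refl , u , v , refl , u∈ , v∈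
    from : ∃[ r ] Δ (suc q) a r × w ∈ R r → a ∷ w ∈ R (suc q)
    from (suc _ , inj₁ refl , u , v , refl , u∈ , v∈) = a ∷ u , v , refl , u∈ , v∈
    from (suc _ , inj₂ (q∈ , refl) , u , v , refl , u∈ , v∈) =
      [] , a ∷ w , refl , q∈ , Star-∷ {X = accepted M} {u = a ∷ u} u∈ v∈

U-regular : ∀ {A} → Regular {A} U
U-regular = record { states = 1 ; initial = zero ; δ = λ _ _ → zero ; final = ⊤ } , (λ _ → ∈⊤) , _

-- Induction on `z`: a fresh state reads the first letter and hands over to the automaton for the
-- rest.
Word-regular : ∀ {A} → DecidableEquality A → (z : List A) → Regular (Word z)
Word-regular _≟_ [] = state-regular {Q = Fin 1} (↪-id _) _≟ᶠ_ (λ _ → Word [])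
  (λ _ → yes refl) {λ _ _ _ → ⊥} (λ _ _ _ → no λ ()) (λ _ _ _ → mk⇔ (λ ()) λ ()) zero
Word-regular {A} _≟_ (b ∷ z) with M , zM , Mz ← Word-regular _≟_ z =
  Regular-resp-≐ ((λ { (w , refl , w∈) → cong (b ∷_) (Mz w∈) }) , λ { refl → z , refl , zM refl })
    (state-regular (↪-id _) _≟ᶠ_ R ν? {Δ} Δ? derivative zero)
  where
  R : Fin (suc (states M)) → Language A
  R zero    w = ∃[ v ] w ≡ b ∷ v × v ∈ accepted M
  R (suc q)   = Residual M q
  ν? : ∀ q → Dec ([] ∈ R q)
  ν? zero    = no λ ()
  ν? (suc q) = q ∈? final M
  Δ : Fin (suc (states M)) → A → Pred (Fin (suc (states M))) 0ℓ
  Δ _       a zero    = ⊥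
  Δ zero    a (suc r) = a ≡ b × r ≡ initial M
  Δ (suc q) a (suc r) = r ≡ δ M q a
  Δ? : ∀ q a → Decidable (Δ q a)
  Δ? zero    a zero    = no λ ()
  Δ? (suc q) a zero    = no λ ()
  Δ? zero    a (suc r) = a ≟ b ×-dec r ≟ᶠ initial M
  Δ? (suc q) a (suc r) = r ≟ᶠ δ M q a
  derivative : ∀ q a w → a ∷ w ∈ R q ⇔ (∃[ r ] Δ q a r × w ∈ R r)
  derivative zero a w = mk⇔ (λ { (_ , refl , w∈) → suc _ , (refl , refl) , w∈ })
                            (λ { (suc _ , (refl , refl) , w∈) → w , refl , w∈ })
  derivative (suc q) a w = mk⇔ (λ w∈ → suc _ , refl , w∈) λ { (suc _ , refl , w∈) → w∈ }

open Automaton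

-- Deciding completeness

module _ {A : Set} where

  Factor-++ : ∀ (p w s : List A) → Factor w (p ++ w ++ s)
  Factor-++ p w s = fromView (MkView p (≡⇒Pointwise-≡ refl) s)

  Factor-split : ∀ {w v : List A} → Factor w v → ∃[ p ] ∃[ s ] v ≡ p ++ w ++ s
  Factor-split w⊑v with toView w⊑v
  ... | MkView p w≋ s with refl ← Pointwise-≡⇒≡ w≋ = p , s , refl

  Factors : Language A → Language A
  Factors L w = ∃[ v ] v ∈ L × Factor w v

  module _ {m} (δ : Fin m → A → Fin m) (q : Fin m) where

    -- Among the `m + 1` prefixes of lengths 0 to `m`, two lead to the same state; the letters
    -- between them are cut out.
    remove-loop : ∀ w → m ≤ length w →
                  ∃[ v ] length v < length w × foldl δ q v ≡ foldl δ q w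
    remove-loop w m≤w
      with i , j , i<j , same ← pigeonhole (n<1+n m) (λ i → foldl δ q (take (toℕ i) w)) =
      take (toℕ i) w ++ drop (toℕ j) w , shorter , state
      where
      shorter : length (take (toℕ i) w ++ drop (toℕ j) w) < length w
      shorter = let open ≤-Reasoning in begin-strict
        length (take (toℕ i) w ++ drop (toℕ j) w)       ≡⟨ length-++ (take (toℕ i) w) ⟩
        length (take (toℕ i) w) + length (drop (toℕ j) w) ≤⟨ +-monoˡ-≤ _ (subst (_≤ toℕ i) (sym (length-take (toℕ i) w)) (m⊓n≤m _ _)) ⟩
        toℕ i + length (drop (toℕ j) w)                 <⟨ +-monoˡ-< _ i<j ⟩
        toℕ j + length (drop (toℕ j) w)                 ≡⟨ cong (toℕ j +_) (length-drop (toℕ j) w) ⟩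
        toℕ j + (length w ∸ toℕ j)                      ≡⟨ m+[n∸m]≡n (≤-trans (toℕ≤pred[n] j) m≤w) ⟩
        length w                                        ∎
      state : foldl δ q (take (toℕ i) w ++ drop (toℕ j) w) ≡ foldl δ q w
      state = let open ≡-Reasoning in begin
        foldl δ q (take (toℕ i) w ++ drop (toℕ j) w)          ≡⟨ foldl-++ δ q (take (toℕ i) w) _ ⟩
        foldl δ (foldl δ q (take (toℕ i) w)) (drop (toℕ j) w) ≡⟨ cong (λ r → foldl δ r (drop (toℕ j) w)) same ⟩
        foldl δ (foldl δ q (take (toℕ j) w)) (drop (toℕ j) w) ≡⟨ foldl-++ δ q (take (toℕ j) w) _ ⟨
        foldl δ q (take (toℕ j) w ++ drop (toℕ j) w)          ≡⟨ cong (foldl δ q) (take++drop≡id (toℕ j) w) ⟩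
        foldl δ q w                                           ∎

    short-path : ∀ w → ∃[ v ] length v ≤ m × foldl δ q v ≡ foldl δ q w
    short-path w = go (length w) w ≤-refl
      where
      -- `l` bounds the length of the word, which drops with each removed loop.
      go : ∀ l w → length w ≤ l → ∃[ v ] length v ≤ m × foldl δ q v ≡ foldl δ q w
      go zero    [] _   = [] , z≤n , refl
      go (suc l) w w≤l with ≤-total (length w) m
      ... | inj₁ w≤m = w , w≤m , refl
      ... | inj₂ m≤w with v , v<w , v≡w ← remove-loop w m≤w
                     with u , u≤m , u≡v ← go l v (s≤s⁻¹ (≤-trans v<w w≤l)) =
        u , u≤m , trans u≡v v≡w

module _ {A : Set} {n : ℕ} (A↔Fin : A ↔ Fin n) where

  private module I = Inverse A↔Fin

  anyLetter? : {P : Pred A 0ℓ} → Decidable P → Dec (∃[ a ] P a)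
  anyLetter? {P} P? = map′ (λ { (i , p) → I.from i , p })
                           (λ { (a , p) → I.to a , subst P (sym (I.strictlyInverseʳ a)) p })
                           (any? (P? ∘ I.from))

  anyWordUpTo? : ∀ l {P : Language A} → Decidable P → Dec (∃[ w ] length w ≤ l × P w)
  anyWordUpTo? zero    P? = map′ (λ p → [] , z≤n , p) (λ { ([] , _ , p) → p }) (P? [])
  anyWordUpTo? (suc l) {P} P? = map′ to from
    (P? [] ⊎-dec anyLetter? (λ a → anyWordUpTo? l {λ w → P (a ∷ w)} (P? ∘ (a ∷_))))
    where
    to : P [] ⊎ (∃[ a ] ∃[ w ] length w ≤ l × P (a ∷ w)) → ∃[ w ] length w ≤ suc l × P w
    to (inj₁ p)                 = [] , z≤n , p
    to (inj₂ (a , w , w≤l , p)) = a ∷ w , s≤s w≤l , p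
    from : ∃[ w ] length w ≤ suc l × P w → P [] ⊎ (∃[ a ] ∃[ w ] length w ≤ l × P (a ∷ w))
    from ([]    , _       , p) = inj₁ p
    from (a ∷ w , s≤s w≤l , p) = inj₂ (a , w , w≤l , p)

  -- By `short-path`, searching the words of length at most `m` is exhaustive.
  reachable? : ∀ {m} (δ : Fin m → A → Fin m) q {P : Pred (Fin m) 0ℓ} → Decidable P →
               Dec (∃[ w ] P (foldl δ q w))
  reachable? {m} δ q {P} P? =
    map′ (λ { (w , _ , p) → w , p })
         (λ { (w , p) → let v , v≤m , v≡w = short-path δ q w in v , v≤m , subst P (sym v≡w) p })
         (anyWordUpTo? m (λ w → P? (foldl δ q w)))

  inhabited? : {L : Language A} → Regular L → Dec (∃[ w ] w ∈ L)
  inhabited? (M , LM , ML) = map′ (λ { (w , w∈) → w , ML w∈ }) (λ { (w , w∈) → w , LM w∈ })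
    (reachable? (δ M) (initial M) (_∈? final M))

  -- The left context is absorbed by starting in any reachable state, the right one by accepting
  -- wherever a final state can still be reached.
  Factors-regular : {L : Language A} → Regular L → Regular (Factors L)
  Factors-regular {L} (M , LM , ML) = Regular-resp-≐ (f , g)
    (system-regular (↪-id _) K ν? (λ q a r → r ≟ᶠ δ M q a)
       (λ q a w → mk⇔ (λ w∈ → _ , refl , w∈) λ { (_ , refl , w∈) → w∈ })
       (λ q → reachable? (δ M) (initial M) (_≟ᶠ q)))
    where
    K : Fin (states M) → Language A
    K q w = ∃[ s ] foldl (δ M) q (w ++ s) ∈ˢ final M
    ν? : ∀ q → Dec ([] ∈ K q)
    ν? q = reachable? (δ M) q (_∈? final M)
    Reached : Pred (Fin (states M)) 0ℓ
    Reached q = ∃[ p ] foldl (δ M) (initial M) p ≡ q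
    f : (λ w → ∃[ q ] Reached q × w ∈ K q) ⊆ Factors L
    f {w} (_ , (p , refl) , s , s∈) = p ++ w ++ s ,
      ML (subst (_∈ˢ final M) (sym (foldl-++ (δ M) (initial M) p (w ++ s))) s∈) , Factor-++ p w s
    g : Factors L ⊆ (λ w → ∃[ q ] Reached q × w ∈ K q)
    g {w} (v , v∈ , w⊑v) with p , s , refl ← Factor-split w⊑v =
      _ , (p , refl) , s , subst (_∈ˢ final M) (foldl-++ (δ M) (initial M) p (w ++ s)) (LM v∈)

  -- The complement is regular, so the search for a missing word is decidable; if it fails,
  -- decidability of `L` removes the double negation.
  universal-or-not : {L : Language A} → Regular L → (∀ w → w ∈ L) ⊎ ∃[ w ] w ∈ ∁ L
  universal-or-not {L} L-regular = decide (inhabited? (∁-regular L-regular))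
    where
    decide : Dec (∃[ w ] w ∈ ∁ L) → (∀ w → w ∈ L) ⊎ ∃[ w ] w ∈ ∁ L
    decide (yes missing) = inj₂ missing
    decide (no ¬missing) = inj₁ λ w → decidable-stable (Regular⇒Decidable L-regular w) (¬missing ∘ (w ,_))

  -- `Complete X` unfolds to universality of `Factors (Star X)`.
  complete-or-missing-factor : {X : Language A} → Regular X →
                               Complete X ⊎ ∃[ w ] w ∈ ∁ (Factors (Star X))
  complete-or-missing-factor X-regular = universal-or-not (Factors-regular (Star-regular X-regular))

-- Completion by a marker

module _ {A : Set} where

  split-≤ : ∀ (u u′ : List A) {v v′} → u ++ v ≡ u′ ++ v′ → length u ≤ length u′ →
            ∃[ h ] u′ ≡ u ++ h × v ≡ h ++ v′
  split-≤ []      u′       eq _ = u′ , refl , eq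
  split-≤ (a ∷ u) (b ∷ u′) eq (s≤s u≤) with refl , eq′ ← ∷-injective eq
    with h , refl , v≡ ← split-≤ u u′ eq′ u≤ = h , refl , v≡

  Factor-trans : ∀ {u v w : List A} → Factor u v → Factor v w → Factor u w
  Factor-trans = Infix-trans trans

  Free : List A → Language A
  Free z = ∁ (Factor z)

  -- The word `h` is the shift from one occurrence of `z` to another: two occurrences coincide or
  -- are disjoint.
  NonOverlapping : List A → Set
  NonOverlapping z = ∀ h {r r′} → z ++ r ≡ h ++ z ++ r′ → h ≡ [] ⊎ ∃[ t ] h ≡ z ++ t

  Prefix-split : ∀ {z w : List A} → Prefix _≡_ z w → ∃[ q ] w ≡ z ++ q
  Prefix-split z≤ with z≋ Prefix.++ q ← Prefix.toView z≤ =
    q , cong (_++ q) (sym (Pointwise-≡⇒≡ z≋))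

  -- Scan from the left for the first position at which `z` is a prefix of what remains.
  first-occurrence : DecidableEquality A → ∀ z → [] ∈ Free z → ∀ w →
                     w ∈ Free z ⊎ ∃[ p ] ∃[ q ] p ∈ Free z × w ≡ p ++ z ++ q
  first-occurrence _≟_ z z⋢[] []      = inj₁ z⋢[]
  first-occurrence _≟_ z z⋢[] (c ∷ w) with prefix? _≟_ z (c ∷ w)
  ... | yes z≤ = let q , eq = Prefix-split z≤ in inj₂ ([] , q , z⋢[] , eq)
  ... | no z≰ with first-occurrence _≟_ z z⋢[] w
  ...   | inj₁ free                 = inj₁ ([ z≰ , free ]′ ∘ ∷⁻)
  ...   | inj₂ (p , q , free , refl) =
    -- If `z` were a prefix of `c ∷ p`, it would be one of the whole word, which `z≰` excludes.
    inj₂ (c ∷ p , q , ([ (λ z≤ → z≰ (z≤ Prefix.++ᵖ (z ++ q))) , free ]′ ∘ ∷⁻) , refl)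

  Free-[]⇒nonempty : ∀ {z} → [] ∈ Free z → 0 < length z
  Free-[]⇒nonempty {[]}    []⋢[] = contradiction (here []) []⋢[]
  Free-[]⇒nonempty {_ ∷ _} _     = z<s

  -- If `g′` is `g ++ h`, the two occurrences of `z` are shifted by `h`. So `h` is empty or begins
  -- with `z`, and the latter puts `z` inside `g′`.
  unique-split : ∀ {z} → NonOverlapping z → ∀ {g g′ r r′} → g ∈ Free z → g′ ∈ Free z →
                 g ++ z ++ r ≡ g′ ++ z ++ r′ → g ≡ g′ × r ≡ r′
  unique-split {z} no-overlap {g} {g′} free free′ eq =
    [ (λ g≤ → shorter-first free′ g≤ eq)
    , (λ g≥ → let g≡ , r≡ = shorter-first free g≥ (sym eq) in sym g≡ , sym r≡) ]′
    (≤-total (length g) (length g′))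
    where
    shorter-first : ∀ {g g′ r r′} → g′ ∈ Free z → length g ≤ length g′ →
                    g ++ z ++ r ≡ g′ ++ z ++ r′ → g ≡ g′ × r ≡ r′
    shorter-first {g} {g′} free′ g≤ eq with split-≤ g g′ eq g≤
    ... | h , refl , eq′ with no-overlap h eq′
    ...   | inj₁ refl       = sym (++-identityʳ g) , ++-cancelˡ z _ _ eq′
    ...   | inj₂ (t , refl) = contradiction (Factor-++ g z t) free′

-- A word of Star (X ∪ Marked) is cut at the occurrences of the marker z. A gap
-- inside a word of Marked is never in Star X, a gap between two such words
-- always is; so the word determines its factorization.
module Completion {A : Set} (X : Language A) (z : List A) where

  Gap : Language A
  Gap = ∁ (Star X ∪ Factor z)

  Marked : Language A
  Marked = Star (Word z · Gap) · Word z

  Completed : Language A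
  Completed = X ∪ Marked

  marker : z ∈ Marked
  marker = [] , z , refl , ([] , [] , refl) , refl

  marker-∷ : ∀ {u y} → u ∈ Gap → y ∈ Marked → z ++ u ++ y ∈ Marked
  marker-∷ {u} u∈ (s , _ , refl , (ss , ss∈ , refl) , refl) =
    z ++ u ++ s , z , trans (++-assoc z (u ++ s) z) (cong (z ++_) (++-assoc u s z)) ,
    ((z ++ u) ∷ ss , (z , u , refl , refl , u∈) ∷ ss∈ , ++-assoc z u s) , refl

  module _ (no-overlap : NonOverlapping z) (missing : z ∈ ∁ (Factors (Star X))) where

    Star-free : ∀ {g} → g ∈ Star X → g ∈ Free z
    Star-free g∈ z⊑g = missing (_ , g∈ , z⊑g)

    -- w = concat zs in Outside zs w, and z ++ w = y ++ concat zs in Inside y zs w.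
    data Outside : List (List A) → List A → Set
    data Inside : List A → List (List A) → List A → Set

    data Outside where
      end  : ∀ {xs} → All X xs → Outside xs (concat xs)
      next : ∀ {xs y zs w} → All X xs → Inside y zs w → Outside (xs ++ y ∷ zs) (concat xs ++ z ++ w)

    data Inside where
      stop : ∀ {zs w} → Outside zs w → Inside z zs w
      more : ∀ {u y zs w} → u ∈ Gap → Inside y zs w → Inside (z ++ u ++ y) zs (u ++ z ++ w)

    Outside-word : ∀ {zs w} → Outside zs w → w ≡ concat zs
    Inside-word  : ∀ {y zs w} → Inside y zs w → z ++ w ≡ y ++ concat zs
    Outside-word (end _) = refl
    Outside-word (next {xs} {y} {zs} {w} _ i) =
      trans (cong (concat xs ++_) (Inside-word i)) (concat-++ xs (y ∷ zs))
    Inside-word (stop o) = cong (z ++_) (Outside-word o)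
    Inside-word (more {u} {y} {zs} {w} _ i) = begin
      z ++ u ++ z ++ w              ≡⟨ cong (λ v → z ++ u ++ v) (Inside-word i) ⟩
      z ++ u ++ y ++ concat zs      ≡⟨ cong (z ++_) (++-assoc u y _) ⟨
      z ++ (u ++ y) ++ concat zs    ≡⟨ ++-assoc z (u ++ y) _ ⟨
      (z ++ u ++ y) ++ concat zs    ∎
      where open ≡-Reasoning

    enter : ∀ {y zs w} → y ∈ Marked → Outside zs w → ∃[ v ] Inside y zs v
    enter {y} {zs} {w} (_ , _ , refl , (ss , ss∈ , refl) , refl) o = go ss ss∈
      where
      go : ∀ ss → All (Word z · Gap) ss → ∃[ v ] Inside (concat ss ++ z) zs v
      go []      []         = w , stop o
      go (_ ∷ ss) ((_ , u , refl , refl , u∈) ∷ ss∈) with v , i ← go ss ss∈ =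
        u ++ z ++ v , subst (λ y → Inside y zs (u ++ z ++ v)) assoc (more u∈ i)
        where
        assoc : z ++ u ++ concat ss ++ z ≡ ((z ++ u) ++ concat ss) ++ z
        assoc = trans (sym (++-assoc z u (concat ss ++ z))) (sym (++-assoc (z ++ u) (concat ss) z))

    -- Consecutive words of `X` are collected into one gap, up to the next marked word or the end.
    parse : ∀ {zs} → All Completed zs → ∃[ w ] Outside zs w
    parse [] = [] , end []
    parse (inj₁ x∈ ∷ zs∈) with parse zs∈
    ... | _ , end xs∈    = _ , end (x∈ ∷ xs∈)
    ... | _ , next xs∈ i = _ , next (x∈ ∷ xs∈) i
    parse (inj₂ y∈ ∷ zs∈) with _ , o ← parse zs∈ with _ , i ← enter y∈ o = _ , next [] i

    module _ (X-code : Code X) where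

      -- Both words are compared up to their first marker: `unique-split` equates the gaps, and the
      -- code `X` factors them uniquely. If only one word has a marker, `z` is a factor of a word of
      -- `Star X`.
      Outside-unique : ∀ {zs zs′ w w′} → Outside zs w → Outside zs′ w′ → w ≡ w′ → zs ≡ zs′
      -- After a marker, the marked word goes on exactly when the next gap is outside `Star X`, so
      -- both parses stop together.
      Inside-unique  : ∀ {y y′ zs zs′ w w′} → Inside y zs w → Inside y′ zs′ w′ → w ≡ w′ →
                       y ≡ y′ × zs ≡ zs′
      -- In an `Outside` word, what precedes the first marker lies in `Star X`, unlike `u`; without
      -- a marker, `z` cannot occur.
      gap≠outside    : ∀ {u zs w w′} → u ∈ Gap → Outside zs w → w ≢ u ++ z ++ w′

      Outside-unique (end xs∈) (end xs∈′) eq = X-code _ _ xs∈ xs∈′ eq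
      Outside-unique (end {xs} xs∈) (next {xs′} {w = w′} _ _) eq =
        contradiction (concat xs , (xs , xs∈ , refl) ,
                       subst (Factor z) (sym eq) (Factor-++ (concat xs′) z w′)) missing
      Outside-unique (next {xs} {w = w} _ _) (end {xs′} xs∈′) eq =
        contradiction (concat xs′ , (xs′ , xs∈′ , refl) ,
                       subst (Factor z) eq (Factor-++ (concat xs) z w)) missing
      Outside-unique (next {xs} xs∈ i) (next {xs′} xs∈′ i′) eq
        with g≡ , w≡ ← unique-split no-overlap (Star-free (xs , xs∈ , refl)) (Star-free (xs′ , xs∈′ , refl)) eq
        with refl ← X-code _ _ xs∈ xs∈′ g≡
        with refl , refl ← Inside-unique i i′ w≡ = refl

      Inside-unique (stop o) (stop o′) eq = refl , Outside-unique o o′ eq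
      Inside-unique (stop o) (more u∈ i′) eq = contradiction eq (gap≠outside u∈ o)
      Inside-unique (more u∈ i) (stop o′) eq = contradiction (sym eq) (gap≠outside u∈ o′)
      Inside-unique (more u∈ i) (more u∈′ i′) eq
        with refl , w≡ ← unique-split no-overlap (u∈ ∘ inj₂) (u∈′ ∘ inj₂) eq
        with refl , refl ← Inside-unique i i′ w≡ = refl , refl

      gap≠outside {u} {w′ = w′} u∈ (end {xs} xs∈) eq =
        missing (concat xs , (xs , xs∈ , refl) , subst (Factor z) (sym eq) (Factor-++ u z w′))
      gap≠outside u∈ (next {xs} xs∈ _) eq
        with refl , _ ← unique-split no-overlap (Star-free (xs , xs∈ , refl)) (u∈ ∘ inj₂) eq =
        u∈ (inj₁ (xs , xs∈ , refl))

      Completed-code : Code Completed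
      Completed-code xs ys xs∈ ys∈ eq with _ , o ← parse xs∈ with _ , o′ ← parse ys∈ =
        Outside-unique o o′ (trans (Outside-word o) (trans eq (sym (Outside-word o′))))

  module _ (_≟_ : DecidableEquality A) (Star-X? : Decidable (Star X)) (z⋢[] : [] ∈ Free z) where

    -- The first factor `y` is kept apart so that a gap outside `Star X` in front of it can be
    -- merged into it by `marker-∷`.
    Bracketed : Language A
    Bracketed w = ∃[ y ] ∃[ r ] y ∈ Marked × r ∈ Star Completed × z ++ w ++ z ≡ y ++ r

    Star-++ : ∀ {u v} → u ∈ Star X → v ∈ Star Completed → u ++ v ∈ Star Completed
    Star-++ (xs , xs∈ , refl) (zs , zs∈ , refl) =
      xs ++ zs , ++⁺ (All.map inj₁ xs∈) zs∈ , sym (concat-++ xs zs)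

    -- Cut `w` at its first marker and recurse on the part behind it, which is shorter because `z`
    -- is nonempty.
    bracketed : ∀ w → Bracketed w
    bracketed w = go w (<-wellFounded (length w))
      where
      go : ∀ w → Acc _<_ (length w) → Bracketed w
      go w (acc rec) with first-occurrence _≟_ z z⋢[] w
      go w (acc rec) | inj₁ free with Star-X? w
      -- A gap in `Star X` separates the two markers into two words; any other gap joins them into
      -- one marked word.
      ... | yes w∈ = z , w ++ z , marker , Star-++ w∈ (z ∷ [] , inj₂ marker ∷ [] , ++-identityʳ z) , refl
      ... | no w∉  = z ++ w ++ z , [] , marker-∷ [ w∉ , free ]′ marker , ([] , [] , refl) , sym (++-identityʳ _)
      go w (acc rec) | inj₂ (p , q , free , refl)
        with y , r , y∈ , r∈ , eq ← go q (rec (<-≤-trans (m<n+m (length q) (Free-[]⇒nonempty z⋢[]))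
               (subst (_≤ length (p ++ z ++ q)) (length-++ z) (length-++-≤ʳ (z ++ q) {p}))))
        = continue (Star-X? p)
        where
        open ≡-Reasoning
        brackets : z ++ (p ++ z ++ q) ++ z ≡ z ++ p ++ y ++ r
        brackets = cong (z ++_) (begin
          (p ++ z ++ q) ++ z ≡⟨ ++-assoc p (z ++ q) z ⟩
          p ++ (z ++ q) ++ z ≡⟨ cong (p ++_) (++-assoc z q z) ⟩
          p ++ z ++ q ++ z   ≡⟨ cong (p ++_) eq ⟩
          p ++ y ++ r        ∎)
        continue : Dec (p ∈ Star X) → Bracketed (p ++ z ++ q)
        continue (yes p∈) = z , p ++ y ++ r , marker , Star-++ p∈ (Star-∷ {X = Completed} {u = y} (inj₂ y∈) r∈) , brackets
        continue (no p∉)  = z ++ p ++ y , r , marker-∷ [ p∉ , free ]′ y∈ , r∈ ,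
          trans brackets (trans (cong (z ++_) (sym (++-assoc p y r))) (sym (++-assoc z (p ++ y) r)))

    Completed-complete : Complete Completed
    Completed-complete w with y , r , y∈ , r∈ , eq ← bracketed w =
      y ++ r , Star-∷ {X = Completed} {u = y} (inj₂ y∈) r∈ , subst (Factor w) eq (Factor-++ z w z)

  Completed-regular : DecidableEquality A → Regular X → Regular Completed
  Completed-regular _≟_ X-regular =
    ∪-regular X-regular (·-regular (Star-regular (·-regular z-regular Gap-regular)) z-regular)
    where
    z-regular : Regular (Word z)
    z-regular = Word-regular _≟_ z
    Factor-regular : Regular (Factor z)
    Factor-regular = Regular-resp-≐
      ( (λ { (p , _ , refl , _ , (_ , s , refl , refl , _)) → Factor-++ p z s })
      , (λ z⊑ → let p , s , eq = Factor-split z⊑ in p , z ++ s , sym eq , _ , (z , s , refl , refl , _)) )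
      (·-regular U-regular (·-regular z-regular U-regular))
    Gap-regular : Regular Gap
    Gap-regular = ∁-regular (∪-regular (Star-regular X-regular) Factor-regular)

-- Prefix distance and markers ending in a bᵐ

module _ {A : Set} where

  longestCommonPrefix-split : (_≟_ : DecidableEquality A) → ∀ v w →
    let p = longestCommonPrefix _≟_ v w in ∃[ s ] ∃[ t ] v ≡ p ++ s × w ≡ p ++ t
  longestCommonPrefix-split _≟_ []      w  = [] , w , refl , refl
  longestCommonPrefix-split _≟_ (a ∷ v) [] = a ∷ v , [] , refl , refl
  longestCommonPrefix-split _≟_ (a ∷ v) (b ∷ w) with a ≟ b
  ... | no _     = a ∷ v , b ∷ w , refl , refl
  ... | yes refl = let s , t , v≡ , w≡ = longestCommonPrefix-split _≟_ v w in
                   s , t , cong (a ∷_) v≡ , cong (a ∷_) w≡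

  -- The letter `a` cannot lie inside the block of `b`s, so the whole block precedes it.
  replicate-past : ∀ {a b : A} → a ≢ b → ∀ m {r s} h → replicate m b ++ r ≡ h ++ a ∷ s →
                   ∃[ t ] h ≡ replicate m b ++ t
  replicate-past a≢b zero    h       _  = h , refl
  replicate-past a≢b (suc m) []      eq = contradiction (sym (proj₁ (∷-injective eq))) a≢b
  replicate-past a≢b (suc m) (c ∷ h) eq with refl , eq′ ← ∷-injective eq
    with t , refl ← replicate-past a≢b m h eq′ = t , refl

  replicate-prefix : ∀ {b : A} m h {s} → replicate m b ≡ h ++ s → h ≡ replicate (length h) b
  replicate-prefix m       []      _  = refl
  replicate-prefix (suc m) (c ∷ h) eq with refl , eq′ ← ∷-injective eq =
    cong (_ ∷_) (replicate-prefix m h eq′)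

  -- Removing at most `m` letters from the end only shortens the final block.
  truncate-replicate : ∀ {b : A} m p q {s} → p ++ s ≡ q ++ replicate m b → length s ≤ m →
                       ∃[ i ] p ≡ q ++ replicate i b
  truncate-replicate {b} m p q {s} eq s≤m =
    let h , p≡ , eq′ = split-≤ q p (sym eq) q≤p in
    length h , trans p≡ (cong (q ++_) (replicate-prefix m h eq′))
    where
    open ≤-Reasoning
    q≤p : length q ≤ length p
    q≤p = +-cancelʳ-≤ (length s) _ _ (begin
      length q + length s               ≤⟨ +-monoʳ-≤ (length q) s≤m ⟩
      length q + m                      ≡⟨ cong (length q +_) (length-replicate m) ⟨
      length q + length (replicate m b) ≡⟨ length-++ q ⟨
      length (q ++ replicate m b)       ≡⟨ cong length eq ⟨
      length (p ++ s)                   ≡⟨ length-++ p ⟩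
      length p + length s               ∎)

  module _ {a b : A} (a≢b : a ≢ b) where

    -- The displayed `a` is the last one in the word: if `q` were properly shorter, another `a`
    -- would follow inside `replicate i b`.
    last-letter-≤ : ∀ q q′ i j → q ++ a ∷ replicate i b ≡ q′ ++ a ∷ replicate j b → length q ≤ length q′ → q ≡ q′
    last-letter-≤ q q′ i j eq q≤ with split-≤ q q′ eq q≤
    ... | []    , refl , _   = sym (++-identityʳ q)
    ... | c ∷ h , refl , eq′ with refl , eq″ ← ∷-injective eq′
      with t , refl ← replicate-past a≢b i h (trans (++-identityʳ _) eq″) =
      contradiction (cong length eq″) (<⇒≢ (begin-strict
        length (replicate i b)                                    ≤⟨ m≤m+n _ (length t) ⟩
        length (replicate i b) + length t                         ≡⟨ length-++ (replicate i b) ⟨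
        length (replicate i b ++ t)                               <⟨ m<m+n _ (s≤s z≤n) ⟩
        length (replicate i b ++ t) + suc (length (replicate j b)) ≡⟨ length-++ (replicate i b ++ t) ⟨
        length ((replicate i b ++ t) ++ a ∷ replicate j b)        ∎))
      where open ≤-Reasoning

    last-letter-unique : ∀ q q′ i j → q ++ a ∷ replicate i b ≡ q′ ++ a ∷ replicate j b → q ≡ q′
    last-letter-unique q q′ i j eq with ≤-total (length q) (length q′)
    ... | inj₁ q≤ = last-letter-≤ q q′ i j eq q≤
    ... | inj₂ q≥ = sym (last-letter-≤ q′ q j i (sym eq) q≥)

    -- The block of `b`s contains no `a`. A long shift puts the first `a` of the second copy at or
    -- behind the start of the block; a short one does so with the `a` in front of the second block.
    -- Either must then lie past the first block.
    nonOverlapping : ∀ v m → length v < m → NonOverlapping (a ∷ v ++ a ∷ replicate m b)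
    nonOverlapping v m v<m []        eq = inj₁ refl
    nonOverlapping v m v<m h@(_ ∷ _) {r} {r′} eq =
      [ inj₂ ∘ far , (λ h<w → contradiction h<w near) ]′ (≤-<-connex (length (w ∷ʳ a)) (length h))
      where
      w = a ∷ v
      B = replicate m b

      regroup : ∀ s → (w ++ a ∷ B) ++ s ≡ (w ∷ʳ a) ++ B ++ s
      regroup s = trans (cong (_++ s) (sym (∷ʳ-++ w a B))) (++-assoc (w ∷ʳ a) B s)

      far : length (w ∷ʳ a) ≤ length h → ∃[ t ] h ≡ (w ++ a ∷ B) ++ t
      far w≤h with t , h≡ , eq′ ← split-≤ (w ∷ʳ a) h (trans (sym (regroup r)) eq) w≤h
        with t′ , refl ← replicate-past a≢b m t eq′ = t′ , trans h≡ (sym (regroup t′))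

      -- Since `h` is nonempty, the second copy's `a` at position `length (h ++ w)` lies behind
      -- `w ∷ʳ a`, hence past `B`. The block is too long for that: `length w` is at most `m`.
      near : ¬ length h < length (w ∷ʳ a)
      near h<w =
        let t  , hw≡ , eq′ = split-≤ (w ∷ʳ a) (h ++ w) realigned
              (subst₂ _≤_ (length-++-comm [ a ] w) (sym (length-++ h)) (+-monoˡ-≤ (length w) (s≤s z≤n)))
            t′ , t≡ = replicate-past a≢b m t eq′
        in contradiction (cong length hw≡) (<⇒≢ (let open ≤-Reasoning in begin-strict
          length (h ++ w)                     ≡⟨ length-++ h ⟩
          length h + length w                 <⟨ +-mono-<-≤ h<w v<m ⟩
          length (w ∷ʳ a) + m                 ≡⟨ cong (length (w ∷ʳ a) +_) (length-replicate m) ⟨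
          length (w ∷ʳ a) + length B          ≤⟨ +-monoʳ-≤ (length (w ∷ʳ a)) (length-++-≤ˡ B) ⟩
          length (w ∷ʳ a) + length (B ++ t′)  ≡⟨ cong (λ t → length (w ∷ʳ a) + length t) t≡ ⟨
          length (w ∷ʳ a) + length t          ≡⟨ length-++ (w ∷ʳ a) ⟨
          length ((w ∷ʳ a) ++ t)              ∎))
        where
        realigned : (w ∷ʳ a) ++ B ++ r ≡ (h ++ w) ++ a ∷ B ++ r′
        realigned = let open ≡-Reasoning in begin
          (w ∷ʳ a) ++ B ++ r        ≡⟨ regroup r ⟨
          (w ++ a ∷ B) ++ r         ≡⟨ eq ⟩
          h ++ (w ++ a ∷ B) ++ r′   ≡⟨ cong (h ++_) (++-assoc w (a ∷ B) r′) ⟩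
          h ++ w ++ a ∷ B ++ r′     ≡⟨ ++-assoc h w _ ⟨
          (h ++ w) ++ a ∷ B ++ r′   ∎

    ends-in-marker : ∀ {m} v p q {t} → p ++ t ≡ q ++ v ++ a ∷ replicate m b → length t ≤ m →
                     ∃[ i ] p ≡ (q ++ v) ++ a ∷ replicate i b
    ends-in-marker {m} v p q {t} eq t≤m =
      let i , p≡ = truncate-replicate m p ((q ++ v) ∷ʳ a) eq′ t≤m in
      i , trans p≡ (∷ʳ-++ (q ++ v) a (replicate i b))
      where
      eq′ : p ++ t ≡ ((q ++ v) ∷ʳ a) ++ replicate m b
      eq′ = trans eq (trans (sym (++-assoc q v _)) (sym (∷ʳ-++ (q ++ v) a (replicate m b))))

-- Independence of the completed code

module _ {A : Set} {n : ℕ} (A↔Fin : A ↔ Fin n) where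

  -- The distance is the total length of the two remainders after the longest common prefix, so each
  -- of them is at most `k`.
  𝒫-split : ∀ {k} v w → 𝒫 A↔Fin k v w →
            ∃[ p ] ∃[ s ] ∃[ t ] v ≡ p ++ s × w ≡ p ++ t × length s ≤ k × length t ≤ k
  𝒫-split {k} v w close =
    let s , t , v≡ , w≡ = longestCommonPrefix-split (inj⇒≟ (↔⇒↣ A↔Fin)) v w
        s+t≤k = subst (_≤ k) (distance _ s t v≡ w≡) close
    in _ , s , t , v≡ , w≡ , m+n≤o⇒m≤o (length s) s+t≤k , m+n≤o⇒n≤o (length s) s+t≤k
    where
    distance : ∀ p s t → v ≡ p ++ s → w ≡ p ++ t →
               (length v + length w) ∸ 2 * length p ≡ length s + length t
    distance p s t refl refl = begin
      (length (p ++ s) + length (p ++ t)) ∸ 2 * l      ≡⟨ cong₂ (λ i j → (i + j) ∸ 2 * l) (length-++ p) (length-++ p) ⟩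
      ((l + length s) + (l + length t)) ∸ 2 * l        ≡⟨ cong (_∸ 2 * l) (rearrange l (length s) (length t)) ⟩
      (2 * l + (length s + length t)) ∸ 2 * l          ≡⟨ m+n∸m≡n (2 * l) _ ⟩
      length s + length t                              ∎
      where
      open ≡-Reasoning
      l = length p
      rearrange : ∀ l i j → (l + i) + (l + j) ≡ 2 * l + (i + j)
      rearrange = solve-∀

  module _ {a b : A} (a≢b : a ≢ b) (X : Language A) (v : List A) (missing : v ∈ ∁ (Factors (Star X)))
           {k m : ℕ} (k≤m : k ≤ m) where

    open Completion X (v ++ a ∷ replicate m b)

    truncated-Marked : ∀ p t → length t ≤ k → p ++ t ∈ Marked →
                       ∃[ q ] ∃[ i ] p ++ t ≡ q ++ v ++ a ∷ replicate m b ×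
                                     p ≡ (q ++ v) ++ a ∷ replicate i b
    truncated-Marked p t t≤k (q , _ , eq , _ , refl) =
      let i , p≡ = ends-in-marker a≢b v p q (sym eq) (≤-trans t≤k k≤m) in q , i , sym eq , p≡

    -- The common prefix `p` still contains `v`, which is a factor of no word of `Star X`.
    X-far-from-Marked : ∀ p s t → length t ≤ k → p ++ t ∈ Marked → p ++ s ∉ X
    X-far-from-Marked p s t t≤k y∈ x∈ with q , i , _ , refl ← truncated-Marked p t t≤k y∈ =
      missing (_ , (_ ∷ [] , x∈ ∷ [] , refl) ,
        subst (Factor v) (regroup (a ∷ replicate i b)) (Factor-++ q v ((a ∷ replicate i b) ++ s)))
      where
      regroup : ∀ r → q ++ v ++ r ++ s ≡ (((q ++ v) ++ r) ++ s) ++ []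
      regroup r = begin
        q ++ v ++ r ++ s            ≡⟨ ++-assoc q v _ ⟨
        (q ++ v) ++ r ++ s          ≡⟨ ++-assoc (q ++ v) r s ⟨
        ((q ++ v) ++ r) ++ s        ≡⟨ ++-identityʳ _ ⟨
        (((q ++ v) ++ r) ++ s) ++ [] ∎
        where open ≡-Reasoning

    -- The last `a` of `p` locates the final marker, so both words are the same `q` followed by the
    -- marker.
    Marked-separated : ∀ p s t → length s ≤ k → length t ≤ k →
                       p ++ s ∈ Marked → p ++ t ∈ Marked → p ++ s ≡ p ++ t
    Marked-separated p s t s≤k t≤k x∈ y∈ =
      let q  , i  , x≡ , p≡  = truncated-Marked p s s≤k x∈
          q′ , i′ , y≡ , p≡′ = truncated-Marked p t t≤k y∈
          q≡ = ++-cancelʳ v q q′ (last-letter-unique a≢b (q ++ v) (q′ ++ v) i i′ (trans (sym p≡) p≡′))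
      in trans x≡ (trans (cong (_++ v ++ a ∷ replicate m b) q≡) (sym y≡))

    Completed-independent : Independent (𝒫̲ A↔Fin k) X → Independent (𝒫̲ A↔Fin k) Completed
    Completed-independent X-independent y ((x , x∈ , close , x≢y) , y∈)
      with p , s , t , refl , refl , s≤k , t≤k ← 𝒫-split x y close with x∈ | y∈
    ... | inj₁ x∈ | inj₁ y∈ = X-independent y ((x , x∈ , close , x≢y) , y∈)
    ... | inj₁ x∈ | inj₂ y∈ = X-far-from-Marked p s t t≤k y∈ x∈
    ... | inj₂ x∈ | inj₁ y∈ = X-far-from-Marked p t s s≤k x∈ y∈
    ... | inj₂ x∈ | inj₂ y∈ = x≢y (Marked-separated p s t s≤k t≤k x∈ y∈)

-- Choice of the marker and the resulting completion

two-letters : {A : Set} {n : ℕ} → A ↔ Fin n → 2 ≤ n → Σ[ a ∈ A ] Σ[ b ∈ A ] a ≢ b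
two-letters A↔Fin (s≤s (s≤s _)) = I.from zero , I.from (suc zero) , λ a≡b →
  case trans (sym (I.strictlyInverseˡ zero)) (trans (cong I.to a≡b) (I.strictlyInverseˡ (suc zero))) of λ ()
  where module I = Inverse A↔Fin

proposition3p11 : {A : Set} {n : ℕ} (A↔Fin : A ↔ Fin n) → 2 ≤ n →
    (k : ℕ) → 1 ≤ k →
    (X : Language A) → Regular X → Independent (𝒫̲ A↔Fin k) X → Code X →
    Σ[ Z ∈ Language A ]
    (Complete Z × Regular Z × Independent (𝒫̲ A↔Fin k) Z × Code Z × X ⊆ Z)
proposition3p11 {A} A↔Fin 2≤n k _ X X-regular X-independent X-code =
  [ complete , incomplete ]′ (complete-or-missing-factor A↔Fin X-regular)
  where
  _≟ᴬ_ : DecidableEquality A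
  _≟ᴬ_ = inj⇒≟ (↔⇒↣ A↔Fin)

  Goal = Σ[ Z ∈ Language A ] (Complete Z × Regular Z × Independent (𝒫̲ A↔Fin k) Z × Code Z × X ⊆ Z)

  complete : Complete X → Goal
  complete X-complete = X , X-complete , X-regular , X-independent , X-code , λ x∈ → x∈

  incomplete : ∃[ w ] w ∈ ∁ (Factors (Star X)) → Goal
  incomplete (w , w-missing) =
      Completed
    -- The empty word belongs to `Star X`, so `z` does not occur in it.
    , Completed-complete _≟ᴬ_ (Regular⇒Decidable (Star-regular X-regular)) (Star-free no-overlap z-missing ([] , [] , refl))
    , Completed-regular _≟ᴬ_ X-regular
    , Completed-independent A↔Fin a≢b X (a ∷ w) aw-missing k≤m X-independent
    , Completed-code no-overlap z-missing X-code
    , inj₁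
    where
    letters = two-letters A↔Fin 2≤n
    a = proj₁ letters
    b = proj₁ (proj₂ letters)
    a≢b = proj₂ (proj₂ letters)
    -- Exceeding `length w` prevents overlaps of `z`; being at least `k` lets the block absorb any
    -- cut of `k` letters.
    m = suc (length w) + k
    -- The leading `a` is the letter that cannot fall into the block of `b`s in another copy of `z`.
    z = a ∷ w ++ a ∷ replicate m b
    open Completion X z
    k≤m : k ≤ m
    k≤m = m≤n+m k _
    no-overlap : NonOverlapping z
    no-overlap = nonOverlapping a≢b w m (m≤m+n _ k)
    extend : ∀ {v} → Factor w v → v ∈ ∁ (Factors (Star X))
    extend w⊑v (x , x∈ , v⊑x) = w-missing (x , x∈ , Factor-trans w⊑v v⊑x)
    aw-missing : a ∷ w ∈ ∁ (Factors (Star X))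
    aw-missing = extend (subst (λ v → Factor w (a ∷ v)) (++-identityʳ w) (Factor-++ (a ∷ []) w []))
    z-missing : z ∈ ∁ (Factors (Star X))
    z-missing = extend (Factor-++ (a ∷ []) w (a ∷ replicate m b))
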